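{- Fix $n\in\mathbb{N}$. The numbers that may appear as denominators of entries in vertices of GT-polytopes in $X_n$ are smaller than $$(n-1)^{\binom{n+1}{2}-n-1}.$$
   Context: For $n\in\mathbb{N}$, $X_n$ is the real vector space of all triangular arrays $(x_{ij})_{1\le i\le j\le n}$ with $x_{ij}\in\mathbb{R}$, so $X_n \cong \mathbb{R}^{n(n+1)/2}$. A Gelfand--Tsetlin pattern (GT-pattern) is an array $(x_{ij})_{1\le i\le j\le n}\in X_n$ with $x_{ij}\ge 0$ for $1\le i\le j\le n$ and $x_{i,j+1}\ge x_{ij}\ge x_{i+1,j+1}$ for $1\le i\le j\le n-1$. For $\lambda,\mu\in\mathbb{Z}^n$, the Gelfand--Tsetlin polytope (GT-polytope) $GT(\lambda,\mu)\subset X_n$ is the convex polytope of all GT-patterns $(x_{ij})_{1\le i\le j\le n}$ with $x_{in}=\lambda_i$ for $1\le i\le n$, $x_{11}=\mu_1$, and $\sum_{i=1}^{j}x_{ij}-\sum_{i=1}^{j-1}x_{i,j-1}=\mu_j$ for $2\le j\le n$. When speaking of a GT-polytope $GT(\lambda,\mu)$, it is always assumed that $\lambda$ and $\mu$ are integral. The vertices of a GT-polytope then have rational entries, and denominators refer to entries written in reduced form.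
   Formalization: For n ≤ 2 the denominator 1 is excluded: at n = 2 the bound is 1 and denominator 1 occurs (λ = μ = (0,0)), so the strict inequality fails, and at n = 1 the bound 0^(-1) is undefined; for n ≥ 3 the claim is unchanged. -}

module Defs where

open import Algebra.Bundles using (CommutativeRing)
open import Algebra.Definitions using (Invertible)
import Algebra.Definitions.RawMonoid as RawMonoidDefs
open import Data.Fin.Base using (Fin; suc; inject₁; toℕ)
open import Data.Fin.Properties using (toℕ<n)
open import Data.Integer.Base using (ℤ; +_; -[1+_]; ∣_∣)
open import Data.Nat.Base as ℕ using (ℕ; suc; NonZero)
open import Data.Nat.Coprimality using (Coprime)
open import Data.Nat.Properties using (≤-refl; <⇒≤)
open import Data.Product.Base using (Σ; _×_)
open import Data.Vec.Functional using (Vector)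
open import Level using (Level; _⊔_) renaming (suc to lsuc)
open import Relation.Binary.Core using (Rel)
import Relation.Binary.Construct.NonStrictToStrict as ToStrict
open import Relation.Binary.Structures using (IsTotalOrder)
open import Relation.Nullary.Negation using (¬_)

-- The standard library has no real numbers, so the field of scalars is an
-- arbitrary (totally) ordered field; ℝ is the intended instance.
record OrderedField (c ℓ₁ ℓ₂ : Level) : Set (lsuc (c ⊔ ℓ₁ ⊔ ℓ₂)) where
  infix 4 _≤_
  field
    commutativeRing : CommutativeRing c ℓ₁
  open CommutativeRing commutativeRing public
  field
    _≤_          : Rel Carrier ℓ₂
    isTotalOrder : IsTotalOrder _≈_ _≤_
    +-monoˡ-≤    : ∀ {x y} z → x ≤ y → x + z ≤ y + z
    *-nonneg     : ∀ {x y} → 0# ≤ x → 0# ≤ y → 0# ≤ x * y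
    0≉1          : ¬ (0# ≈ 1#)
    invertible   : ∀ {x} → ¬ (x ≈ 0#) → Invertible _≈_ 1# _*_ x

  open ToStrict _≈_ _≤_ public using (_<_)
  open RawMonoidDefs +-rawMonoid public using (sum) renaming (_×_ to _·_)

  fromℤ : ℤ → Carrier
  fromℤ (+ k)    = k · 1#
  fromℤ -[1+ k ] = - (suc k · 1#)

module GelfandTsetlin {c ℓ₁ ℓ₂ : Level} (K : OrderedField c ℓ₁ ℓ₂) where
  open OrderedField K

  -- The array (xᵢⱼ), 1 ≤ i ≤ j ≤ n, is stored by its second index:
  -- x j _ = (x₁ⱼ , … , xⱼⱼ), so xᵢⱼ is x j _ applied to the (i-1)-st element
  -- of Fin j.  The additional row j = 0 is the empty vector.
  X : ℕ → Set c
  X n = (j : ℕ) → .(j ℕ.≤ n) → Vector Carrier j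

  infix 4 _≋_
  _≋_ : {n : ℕ} → Rel (X n) ℓ₁
  _≋_ {n} x y = (j : ℕ) (j≤n : j ℕ.≤ n) (i : Fin j) → x j j≤n i ≈ y j j≤n i

  -- (1 - t) y + t z
  segment : {n : ℕ} → Carrier → X n → X n → X n
  segment t y z j j≤n i = (1# - t) * y j j≤n i + t * z j j≤n i

  -- Vertices of a polytope are its extreme points.
  record IsVertex {n : ℕ} {p : Level} (P : X n → Set p) (x : X n)
                  : Set (c ⊔ ℓ₁ ⊔ ℓ₂ ⊔ p) where
    field
      member  : P x
      extreme : (y z : X n) (t : Carrier) → P y → P z → 0# < t → t < 1# →
                x ≋ segment t y z → (y ≋ x) × (z ≋ x)

  -- For i : Fin j representing xᵢⱼ, the entries xᵢ,ⱼ₊₁ and xᵢ₊₁,ⱼ₊₁ sit at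
  -- inject₁ i and suc i.
  record IsGTPattern {n : ℕ} (x : X n) : Set ℓ₂ where
    field
      nonneg : (j : ℕ) (j≤n : j ℕ.≤ n) (i : Fin j) → 0# ≤ x j j≤n i
      upper  : (j : ℕ) (j<n : j ℕ.< n) (i : Fin j) →
               x j (<⇒≤ j<n) i ≤ x (suc j) j<n (inject₁ i)
      lower  : (j : ℕ) (j<n : j ℕ.< n) (i : Fin j) →
               x (suc j) j<n (suc i) ≤ x j (<⇒≤ j<n) i

  -- Since row 0 is empty, the weight condition at k = 0 reads x₁₁ = μ₁.
  record GT {n : ℕ} (lam mu : Vector ℤ n) (x : X n) : Set (ℓ₁ ⊔ ℓ₂) where
    field
      isGTPattern : IsGTPattern x
      top         : (i : Fin n) → x n ≤-refl i ≈ fromℤ (lam i)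
      weight      : (k : Fin n) →
                    sum (x (suc (toℕ k)) (toℕ<n k))
                      - sum (x (toℕ k) (<⇒≤ (toℕ<n k))) ≈ fromℤ (mu k)

  -- a = p / q in reduced form for some integer p.
  record IsDenominatorOf (q : ℕ) (a : Carrier) : Set ℓ₁ where
    field
      numerator : ℤ
      positive  : NonZero q
      reduced   : Coprime ∣ numerator ∣ q
      fraction  : q · a ≈ fromℤ numerator

  -- q is the denominator of an entry of a vertex of some GT(λ, μ) ⊂ Xₙ.
  AppearsAsDenominator : ℕ → ℕ → Set (c ⊔ ℓ₁ ⊔ ℓ₂)
  AppearsAsDenominator n q =
    Σ (Vector ℤ n) λ lam → Σ (Vector ℤ n) λ mu →
    Σ (X n) λ x → IsVertex (GT lam mu) x ×
    (Σ ℕ λ j → Σ (j ℕ.≤ n) λ j≤n → Σ (Fin j) λ i → IsDenominatorOf q (x j j≤n i))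

{-# OPTIONS --safe #-}
module Submission where

-- Let x be a vertex of GT(λ, μ), let q be the denominator of one of its entries,
-- and consider the arrays {k x} of fractional parts for 0 ≤ k < q.  The row sums
-- of x are integers, so the sum of row j of {k x} is an integer in [0, j), and the
-- top row of {k x} vanishes.  If q > (n - 1)!, then by the pigeonhole principle
-- some d = {k x} - {l x} with k < l has all row sums zero.  Equal entries of x have
-- equal fractional parts, so x ± ε d satisfies all the inequalities for small ε > 0
-- and lies in GT(λ, μ); extremality forces d = 0.  Then (l - k) x is integral, so q
-- divides l - k < q, a contradiction.  Hence q ≤ (n - 1)!.

open import Defs
open import Data.Fin.Base as Fin using (Fin; zero; suc; toℕ)
import Data.Fin.Properties as Fin
import Data.Integer.Base as ℤ
open import Data.Nat.Coprimality as Coprimality using (coprime-divisor)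
open import Data.Nat.Divisibility using (_∣_; divides; ∣⇒≤)
import Data.Nat.Base as ℕ
import Data.Nat.Properties as ℕ
open import Data.Nat.Base using (ℕ; zero; suc; _!)
open import Data.Product.Base using (Σ; _×_; _,_; proj₁; proj₂)
open import Data.Sum.Base using (_⊎_; inj₁; inj₂)
open import Data.Vec.Functional using (Vector)
open import Function.Base using (_∘_)
open import Level using (_⊔_)
open import Relation.Binary.Bundles using (Poset)
open import Relation.Binary.PropositionalEquality as ≡ using (_≡_)
open import Relation.Binary.Structures using (IsTotalOrder)
import Relation.Binary.Reasoning.PartialOrder as PartialOrderReasoning
open import Relation.Nullary.Negation using (¬_; contradiction)
open import Relation.Nullary.Decidable using (Dec; yes; no; ¬¬-excluded-middle)
import Algebra.Properties.AbelianGroup as AbelianGroupProperties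
import Algebra.Properties.CommutativeMonoid.Mult as CommutativeMonoidMult
import Algebra.Properties.CommutativeMonoid.Sum as CommutativeMonoidSum
import Algebra.Properties.Semiring.Mult as SemiringMult
import Algebra.Properties.Semiring.Sum as SemiringSum
import Algebra.Solver.Ring.NaturalCoefficients.Default as SemiringSolver

-- Coding digit sequences in the factorial number system

mixedRadix : ∀ m → (∀ j → .(j ℕ.< m) → Fin (suc j)) → Fin (m !)
mixedRadix zero    r = zero
-- Digit `j` has `j + 1` possible values, so the top digit and the code of the lower ones together
-- range over `suc m * m !`, which is `suc m !` by definition.
mixedRadix (suc m) r = Fin.combine (r m ℕ.≤-refl) (mixedRadix m λ j j<m → r j (ℕ.m≤n⇒m≤1+n j<m))

mixedRadix-injective : ∀ m (r s : ∀ j → .(j ℕ.< m) → Fin (suc j)) → mixedRadix m r ≡ mixedRadix m s →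
                       ∀ j (j<m : j ℕ.< m) → r j j<m ≡ s j j<m
mixedRadix-injective (suc m) r s eq j j<1+m
  with Fin.combine-injective (r m ℕ.≤-refl) _ (s m ℕ.≤-refl) _ eq | ℕ.m<1+n⇒m<n∨m≡n j<1+m
... | _   , eq′ | inj₁ j<m    = mixedRadix-injective m _ _ eq′ j j<m
... | eqₘ , _   | inj₂ ≡.refl = eqₘ

-- Order and arithmetic in an ordered field

module OrderedFieldProperties {c ℓ₁ ℓ₂} (K : OrderedField c ℓ₁ ℓ₂) where
  open OrderedField K hiding (zero)
  open IsTotalOrder isTotalOrder public
    using (antisym; total; isPartialOrder)
    renaming (refl to ≤-refl; trans to ≤-trans; reflexive to ≤-reflexive)
  open AbelianGroupProperties +-abelianGroup public
    using () renaming (∙-cancelʳ to +-cancelʳ; x∙y⁻¹≈ε⇒x≈y to x-y≈0⇒x≈y;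
                       //-rightDividesˡ to x-y+y≈x; ⁻¹-anti-homo‿- to -[x-y]≈y-x)
  open CommutativeMonoidMult +-commutativeMonoid public using (×-distrib-+)
  open SemiringMult semiring public
    using (×-homo-+; ×-assocˡ; ×-congʳ)
  open SemiringSolver commutativeSemiring public using (solve; _:+_; _:*_; _:=_; con)

  poset : Poset c ℓ₁ ℓ₂
  poset = record { isPartialOrder = isPartialOrder }

  module ≤-Reasoning = PartialOrderReasoning poset
  open ≤-Reasoning

  +-monoʳ-≤ : ∀ {x y} z → x ≤ y → z + x ≤ z + y
  +-monoʳ-≤ {x} {y} z x≤y = begin
    z + x ≈⟨ +-comm z x ⟩
    x + z ≤⟨ +-monoˡ-≤ z x≤y ⟩
    y + z ≈⟨ +-comm y z ⟩
    z + y ∎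

  +-mono-≤ : ∀ {x y u v} → x ≤ y → u ≤ v → x + u ≤ y + v
  +-mono-≤ {y = y} {u} x≤y u≤v = ≤-trans (+-monoˡ-≤ u x≤y) (+-monoʳ-≤ y u≤v)

  +-cancelʳ-≤ : ∀ {x y} z → x + z ≤ y + z → x ≤ y
  +-cancelʳ-≤ {x} {y} z x+z≤y+z = begin
    x             ≈⟨ shift x ⟩
    x + z + - z   ≤⟨ +-monoˡ-≤ (- z) x+z≤y+z ⟩
    y + z + - z   ≈⟨ shift y ⟨
    y             ∎
    where
    shift : ∀ w → w ≈ w + z + - z
    shift w = sym (trans (+-assoc w z (- z))
                         (trans (+-congˡ (-‿inverseʳ z)) (+-identityʳ w)))

  +-mono-<-≤ : ∀ {x y u v} → x < y → u ≤ v → x + u < y + v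
  +-mono-<-≤ {x} {y} {u} {v} (x≤y , x≉y) u≤v = +-mono-≤ x≤y u≤v , λ eq →
    x≉y (antisym x≤y (+-cancelʳ-≤ u (begin
      y + u ≤⟨ +-monoʳ-≤ y u≤v ⟩
      y + v ≈⟨ eq ⟨
      x + u ∎)))

  x≤y⇒0≤y-x : ∀ {x y} → x ≤ y → 0# ≤ y - x
  x≤y⇒0≤y-x {x} {y} x≤y = begin
    0#    ≈⟨ -‿inverseʳ x ⟨
    x - x ≤⟨ +-monoˡ-≤ (- x) x≤y ⟩
    y - x ∎

  *-monoˡ-≤ : ∀ {x y z} → 0# ≤ z → x ≤ y → z * x ≤ z * y
  *-monoˡ-≤ {x} {y} {z} 0≤z x≤y = begin
    z * x                 ≈⟨ +-identityˡ (z * x) ⟨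
    0# + z * x            ≤⟨ +-monoˡ-≤ (z * x) (*-nonneg 0≤z (x≤y⇒0≤y-x x≤y)) ⟩
    z * (y - x) + z * x   ≈⟨ distribˡ z (y - x) x ⟨
    z * (y - x + x)       ≈⟨ *-congˡ (x-y+y≈x x y) ⟩
    z * y                 ∎

  0≤1 : 0# ≤ 1#
  0≤1 with total 0# 1#
  ... | inj₁ 0≤1 = 0≤1
  ... | inj₂ 1≤0 = begin
    0#            ≤⟨ *-nonneg 0≤-1 0≤-1 ⟩
    -- With a = `0# - 1#`, both `a * a` and `1#` give zero when a is added, since a * a + a = a * (a
    -- + 1) and a + 1 = 0.
    (0# - 1#) * (0# - 1#)  ≈⟨ +-cancelʳ (0# - 1#) _ _ (begin-equality
      (0# - 1#) * (0# - 1#) + (0# - 1#) ≈⟨ solve 1 (λ a → a :* a :+ a := a :* (a :+ con 1)) refl (0# - 1#) ⟩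
      (0# - 1#) * (0# - 1# + 1#)        ≈⟨ *-congˡ (x-y+y≈x 1# 0#) ⟩
      (0# - 1#) * 0#                    ≈⟨ zeroʳ (0# - 1#) ⟩
      0#                                ≈⟨ x-y+y≈x 1# 0# ⟨
      (0# - 1#) + 1#                    ≈⟨ +-comm _ 1# ⟩
      1# + (0# - 1#)                    ∎) ⟩
    1#            ∎
    where
    0≤-1 : 0# ≤ 0# - 1#
    0≤-1 = x≤y⇒0≤y-x 1≤0

  1≰0 : ¬ (1# ≤ 0#)
  1≰0 1≤0 = 0≉1 (antisym 0≤1 1≤0)

  0<1 : 0# < 1#
  0<1 = 0≤1 , 0≉1

  1+-positive : ∀ {x} → 0# ≤ x → ¬ (1# + x ≤ 0#)
  1+-positive {x} 0≤x 1+x≤0 = 1≰0 (begin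
    1#      ≈⟨ +-identityʳ 1# ⟨
    1# + 0# ≤⟨ +-monoʳ-≤ 1# 0≤x ⟩
    1# + x  ≤⟨ 1+x≤0 ⟩
    0#      ∎)

  *-cancelˡ-≈0 : ∀ {x y} → ¬ (x ≈ 0#) → x * y ≈ 0# → y ≈ 0#
  *-cancelˡ-≈0 {x} {y} x≉0 xy≈0 with x⁻¹ , x⁻¹x≈1 , _ ← invertible x≉0 = begin-equality
    y               ≈⟨ *-identityˡ y ⟨
    1# * y          ≈⟨ *-congʳ x⁻¹x≈1 ⟨
    x⁻¹ * x * y     ≈⟨ *-assoc x⁻¹ x y ⟩
    x⁻¹ * (x * y)   ≈⟨ *-congˡ xy≈0 ⟩
    x⁻¹ * 0#        ≈⟨ zeroʳ x⁻¹ ⟩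
    0#              ∎

  -- Serves twice: as the parameter of the midpoint in the extremality test, and to split the slack
  -- of a strict inequality evenly.
  half : Σ Carrier λ h → h + h ≈ 1#
  half with h , _ , 2h≈1 ← invertible {1# + 1#} (λ 2≈0 → 1+-positive 0≤1 (≤-reflexive 2≈0)) =
    h , trans (solve 1 (λ h → h :+ h := (con 1 :+ con 1) :* h) refl h) 2h≈1

  ½ : Carrier
  ½ = proj₁ half

  ½+½≈1 : ½ + ½ ≈ 1#
  ½+½≈1 = proj₂ half

  0<½ : 0# < ½
  0<½ = 0≤½ , λ 0≈½ → 0≉1 (trans (trans (sym (+-identityʳ 0#)) (+-cong 0≈½ 0≈½)) ½+½≈1)
    where
    0≤½ : 0# ≤ ½
    0≤½ with total 0# ½
    ... | inj₁ 0≤½ = 0≤½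
    ... | inj₂ ½≤0 = contradiction (begin
      1#       ≈⟨ ½+½≈1 ⟨
      ½ + ½    ≤⟨ +-mono-≤ ½≤0 ½≤0 ⟩
      0# + 0#  ≈⟨ +-identityʳ 0# ⟩
      0#       ∎) 1≰0

  ½<1 : ½ < 1#
  ½<1 = begin-strict
    ½       ≈⟨ +-identityˡ ½ ⟨
    0# + ½  <⟨ +-mono-<-≤ 0<½ ≤-refl ⟩
    ½ + ½   ≈⟨ ½+½≈1 ⟩
    1#      ∎

  1-½≈½ : 1# - ½ ≈ ½
  1-½≈½ = +-cancelʳ ½ _ _ (trans (x-y+y≈x ½ 1#) (sym ½+½≈1))

  -- Natural multiples and integral elements

  ×-nonneg : ∀ n {x} → 0# ≤ x → 0# ≤ n · x
  ×-nonneg zero          0≤x = ≤-refl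
  ×-nonneg (suc n) {x}   0≤x = begin
    0#         ≈⟨ +-identityʳ 0# ⟨
    0# + 0#    ≤⟨ +-mono-≤ 0≤x (×-nonneg n 0≤x) ⟩
    x + n · x  ∎

  ×-monoʳ-≤ : ∀ n {x y} → x ≤ y → n · x ≤ n · y
  ×-monoʳ-≤ zero    x≤y = ≤-refl
  ×-monoʳ-≤ (suc n) x≤y = +-mono-≤ x≤y (×-monoʳ-≤ n x≤y)

  ×1-cancel-≤ : ∀ {m n} → m · 1# ≤ n · 1# → m ℕ.≤ n
  ×1-cancel-≤ {zero}          m≤n = ℕ.z≤n
  ×1-cancel-≤ {suc m} {zero}  m≤n = contradiction m≤n (1+-positive (×-nonneg m 0≤1))
  ×1-cancel-≤ {suc m} {suc n} m≤n = ℕ.s≤s (×1-cancel-≤ (+-cancelʳ-≤ 1# (begin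
    m · 1# + 1# ≈⟨ +-comm _ 1# ⟩
    1# + m · 1# ≤⟨ m≤n ⟩
    1# + n · 1# ≈⟨ +-comm _ 1# ⟨
    n · 1# + 1# ∎)))

  ×1-mono-≤ : ∀ {m n} → m ℕ.≤ n → m · 1# ≤ n · 1#
  ×1-mono-≤ {n = n} ℕ.z≤n       = ×-nonneg n 0≤1
  ×1-mono-≤         (ℕ.s≤s m≤n) = +-monoʳ-≤ 1# (×1-mono-≤ m≤n)

  ×1-cancel-< : ∀ {m n} → m · 1# < n · 1# → m ℕ.< n
  ×1-cancel-< (m≤n , m≉n) = ℕ.≰⇒> λ n≤m → m≉n (antisym m≤n (×1-mono-≤ n≤m))

  ×1-injective : ∀ {m n} → m · 1# ≈ n · 1# → m ≡ n
  ×1-injective eq =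
    ℕ.≤-antisym (×1-cancel-≤ (≤-reflexive eq)) (×1-cancel-≤ (≤-reflexive (sym eq)))

  -- An integer is represented as a difference of naturals `p` and `q`, stated additively, so that
  -- closure under sums needs no case distinction on signs.
  IsIntegral : Carrier → Set ℓ₁
  IsIntegral a = Σ ℕ λ p → Σ ℕ λ q → a + q · 1# ≈ p · 1#

  integral-cong : ∀ {a b} → a ≈ b → IsIntegral a → IsIntegral b
  integral-cong a≈b (p , q , eq) = p , q , trans (+-congʳ (sym a≈b)) eq

  integral-+ : ∀ {a b} → IsIntegral a → IsIntegral b → IsIntegral (a + b)
  integral-+ {a} {b} (p , q , a+q≈p) (p′ , q′ , b+q′≈p′) = p ℕ.+ p′ , q ℕ.+ q′ , (begin-equality
    a + b + (q ℕ.+ q′) · 1#          ≈⟨ +-congˡ (×-homo-+ 1# q q′) ⟩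
    a + b + (q · 1# + q′ · 1#)       ≈⟨ solve 4 (λ a b x y → a :+ b :+ (x :+ y) := a :+ x :+ (b :+ y))
                                          refl a b (q · 1#) (q′ · 1#) ⟩
    a + q · 1# + (b + q′ · 1#)       ≈⟨ +-cong a+q≈p b+q′≈p′ ⟩
    p · 1# + p′ · 1#                 ≈⟨ ×-homo-+ 1# p p′ ⟨
    (p ℕ.+ p′) · 1#                  ∎)

  integral-× : ∀ k {a} → IsIntegral a → IsIntegral (k · a)
  integral-× zero    int-a = 0 , 0 , +-identityʳ 0#
  integral-× (suc k) int-a = integral-+ int-a (integral-× k int-a)

  integral-cancel : ∀ {a b} m → b + m · 1# ≈ a → IsIntegral a → IsIntegral b
  integral-cancel {a} {b} m b+m≈a (p , q , a+q≈p) = p , m ℕ.+ q , (begin-equality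
    b + (m ℕ.+ q) · 1#        ≈⟨ +-congˡ (×-homo-+ 1# m q) ⟩
    b + (m · 1# + q · 1#)     ≈⟨ +-assoc b _ _ ⟨
    b + m · 1# + q · 1#       ≈⟨ +-congʳ b+m≈a ⟩
    a + q · 1#                ≈⟨ a+q≈p ⟩
    p · 1#                    ∎)

  integral-fromℤ : ∀ z → IsIntegral (fromℤ z)
  integral-fromℤ (ℤ.+ k)    = k , 0 , +-identityʳ _
  integral-fromℤ ℤ.-[1+ k ] = 0 , suc k , -‿inverseˡ _

  integral-nonneg : ∀ {a} → IsIntegral a → 0# ≤ a → Σ ℕ λ s → a ≈ s · 1#
  integral-nonneg {a} (p , q , a+q≈p) 0≤a = p ℕ.∸ q , +-cancelʳ (q · 1#) _ _ (begin-equality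
    a + q · 1#                     ≈⟨ a+q≈p ⟩
    p · 1#                         ≡⟨ ≡.cong (_· 1#) (ℕ.m∸n+n≡m q≤p) ⟨
    (p ℕ.∸ q ℕ.+ q) · 1#           ≈⟨ ×-homo-+ 1# (p ℕ.∸ q) q ⟩
    (p ℕ.∸ q) · 1# + q · 1#        ∎)
    where
    q≤p : q ℕ.≤ p
    q≤p = ×1-cancel-≤ (begin
      q · 1#       ≈⟨ +-identityˡ _ ⟨
      0# + q · 1#  ≤⟨ +-monoˡ-≤ (q · 1#) 0≤a ⟩
      a + q · 1#   ≈⟨ a+q≈p ⟩
      p · 1#       ∎)

  integral-bounded : ∀ {a j} → IsIntegral a → 0# ≤ a → a < j · 1# →
                     Σ (Fin j) λ s → a ≈ toℕ s · 1#
  integral-bounded {a} {j} int-a 0≤a a<j with s , a≈s ← integral-nonneg int-a 0≤a =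
    Fin.fromℕ< s<j , trans a≈s (reflexive (≡.cong (_· 1#) (≡.sym (Fin.toℕ-fromℕ< s<j))))
    where
    s<j : s ℕ.< j
    s<j = ×1-cancel-< (begin-strict
      s · 1# ≈⟨ a≈s ⟨
      a      <⟨ a<j ⟩
      j · 1# ∎)

  -- Floors and fractional parts

  record Floor (a : Carrier) : Set (ℓ₁ ⊔ ℓ₂) where
    field
      floor   : ℕ
      floor-≤ : floor · 1# ≤ a
      floor-< : a < suc floor · 1#

    frac : Carrier
    frac = a - floor · 1#

    frac+floor : frac + floor · 1# ≈ a
    frac+floor = x-y+y≈x (floor · 1#) a

    frac-nonneg : 0# ≤ frac
    frac-nonneg = x≤y⇒0≤y-x floor-≤

    frac<1 : frac < 1#
    frac<1 = (+-cancelʳ-≤ (floor · 1#) (begin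
      frac + floor · 1#  ≈⟨ frac+floor ⟩
      a                  ≤⟨ proj₁ floor-< ⟩
      1# + floor · 1#    ∎)) , λ frac≈1 → proj₂ floor-< (trans (sym frac+floor) (+-congʳ frac≈1))

    frac≤1 : frac ≤ 1#
    frac≤1 = proj₁ frac<1

  open Floor public

  -- Floors are unique: each one lies strictly below the successor of the other.
  frac-cong : ∀ {a b} → a ≈ b → (A : Floor a) (B : Floor b) → frac A ≈ frac B
  frac-cong {a} {b} a≈b A B = +-cong a≈b
    (-‿cong (reflexive (≡.cong (_· 1#) (ℕ.≤-antisym (le a≈b A B) (le (sym a≈b) B A)))))
    where
    le : ∀ {a b} → a ≈ b → (A : Floor a) (B : Floor b) → floor A ℕ.≤ floor B
    le {a} {b} a≈b A B = ℕ.s≤s⁻¹ (×1-cancel-< (begin-strict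
      floor A · 1#        ≤⟨ floor-≤ A ⟩
      a                   ≈⟨ a≈b ⟩
      b                   <⟨ floor-< B ⟩
      suc (floor B) · 1#  ∎))

  -- The fractional part differs from `a` by a natural number, so it is an integer in the interval
  -- [0, 1).
  frac-integral : ∀ {a} (A : Floor a) → IsIntegral a → frac A ≈ 0#
  frac-integral A int-a
    with integral-bounded {j = 1} (integral-cancel (floor A) (frac+floor A) int-a) (frac-nonneg A)
           (begin-strict
             frac A   <⟨ frac<1 A ⟩
             1#       ≈⟨ +-identityʳ 1# ⟨
             1 · 1#   ∎)
  ... | zero , frac≈0 = frac≈0

  -- Descends from the upper bound `N`. Totality alone cannot make the upper inequality strict; that
  -- takes a test for equality with `suc N · 1#`, which is available under double negation.
  ¬¬-floor : ∀ N {a} → 0# ≤ a → a ≤ N · 1# → ¬ ¬ Floor a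
  ¬¬-floor zero {a} 0≤a a≤0 k = k record
    { floor = 0 ; floor-≤ = 0≤a ; floor-< = begin-strict
        a       ≤⟨ a≤0 ⟩
        0#      <⟨ 0<1 ⟩
        1#      ≈⟨ +-identityʳ 1# ⟨
        1 · 1#  ∎ }
  ¬¬-floor (suc N) {a} 0≤a a≤1+N k = ¬¬-excluded-middle no-floor
    where
    no-floor : ¬ Dec (a ≈ suc N · 1#)
    no-floor (yes a≈1+N) = k record
      { floor = suc N ; floor-≤ = ≤-reflexive (sym a≈1+N) ; floor-< = begin-strict
          a                    ≈⟨ a≈1+N ⟩
          suc N · 1#           ≈⟨ +-identityˡ _ ⟨
          0# + suc N · 1#      <⟨ +-mono-<-≤ 0<1 ≤-refl ⟩
          suc (suc N) · 1#     ∎ }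
    no-floor (no a≉1+N) with total a (N · 1#)
    ... | inj₁ a≤N = ¬¬-floor N 0≤a a≤N k
    ... | inj₂ N≤a = k record { floor = N ; floor-≤ = N≤a ; floor-< = a≤1+N , a≉1+N }

  -- Sums of fractional parts

  open CommutativeMonoidSum +-commutativeMonoid public using (sum-cong-≋; ∑-distrib-+)
  open SemiringSum semiring public using (*-distribˡ-sum)

  sum-nonneg : ∀ {n} (v : Vector Carrier n) → (∀ i → 0# ≤ v i) → 0# ≤ sum v
  sum-nonneg {zero}  v 0≤v = ≤-refl
  sum-nonneg {suc n} v 0≤v = begin
    0#       ≈⟨ +-identityʳ 0# ⟨
    0# + 0#  ≤⟨ +-mono-≤ (0≤v zero) (sum-nonneg (v ∘ suc) (0≤v ∘ suc)) ⟩
    sum v    ∎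

  sum-≤ : ∀ {n} (v : Vector Carrier n) → (∀ i → v i ≤ 1#) → sum v ≤ n · 1#
  sum-≤ {zero}  v v≤1 = ≤-refl
  sum-≤ {suc n} v v≤1 = +-mono-≤ (v≤1 zero) (sum-≤ (v ∘ suc) (v≤1 ∘ suc))

  sum-< : ∀ {n} (v : Vector Carrier (suc n)) → (∀ i → v i < 1#) → sum v < suc n · 1#
  sum-< v v<1 = +-mono-<-≤ (v<1 zero) (sum-≤ (v ∘ suc) (proj₁ ∘ v<1 ∘ suc))

  ×-zeroʳ : ∀ k → k · 0# ≈ 0#
  ×-zeroʳ zero    = refl
  ×-zeroʳ (suc k) = trans (+-identityˡ _) (×-zeroʳ k)

  -- The witness is the sum of the floors. It transfers integrality from the sum of a row to the sum
  -- of its fractional parts.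
  sum-frac+floors : ∀ {n} k (v : Vector Carrier n) (fl : ∀ i → Floor (k · v i)) →
                    Σ ℕ λ m → sum (frac ∘ fl) + m · 1# ≈ k · sum v
  sum-frac+floors {zero}  k v fl = 0 , trans (+-identityʳ 0#) (sym (×-zeroʳ k))
  sum-frac+floors {suc n} k v fl with m , eq ← sum-frac+floors k (v ∘ suc) (fl ∘ suc) =
    b ℕ.+ m , (begin-equality
      a + s + (b ℕ.+ m) · 1#          ≈⟨ +-congˡ (×-homo-+ 1# b m) ⟩
      a + s + (b · 1# + m · 1#)       ≈⟨ solve 4 (λ a s b m → a :+ s :+ (b :+ m) := a :+ b :+ (s :+ m))
                                          refl a s (b · 1#) (m · 1#) ⟩
      a + b · 1# + (s + m · 1#)       ≈⟨ +-cong (frac+floor (fl zero)) eq ⟩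
      k · v zero + k · sum (v ∘ suc)  ≈⟨ ×-distrib-+ _ _ k ⟨
      k · sum v                       ∎)
    where
    a = frac (fl zero)
    b = floor (fl zero)
    s = sum (frac ∘ fl ∘ suc)

  integral-sum-frac : ∀ {n} k (v : Vector Carrier n) (fl : ∀ i → Floor (k · v i)) →
                      IsIntegral (sum v) → IsIntegral (sum (frac ∘ fl))
  integral-sum-frac k v fl int-v with m , eq ← sum-frac+floors k v fl =
    integral-cancel m eq (integral-× k int-v)

  -- A sum of `suc n` numbers in [0, 1) lies in [0, `suc n`); being an integer, it has only `suc n`
  -- possible values. These values are the digits to be coded.
  sum-frac-residue : ∀ {n} k (v : Vector Carrier (suc n)) (fl : ∀ i → Floor (k · v i)) →
                     IsIntegral (sum v) → Σ (Fin (suc n)) λ s → sum (frac ∘ fl) ≈ toℕ s · 1#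
  sum-frac-residue k v fl int-v = integral-bounded (integral-sum-frac k v fl int-v)
    (sum-nonneg _ (frac-nonneg ∘ fl)) (sum-< _ (frac<1 ∘ fl))

  -- Sufficiently small parameters and perturbed inequalities

  Near0 : ∀ {p} → (Carrier → Set p) → Set _
  Near0 P = Σ Carrier λ e → 0# < e × (∀ {e′} → e′ ≤ e → P e′)

  -- The smaller threshold serves both properties, because `Near0` asks for the property at every
  -- value below its threshold.
  near0-× : ∀ {p r} {P : Carrier → Set p} {R : Carrier → Set r} →
            Near0 P → Near0 R → Near0 (λ e → P e × R e)
  near0-× (e₁ , 0<e₁ , p) (e₂ , 0<e₂ , r) with total e₁ e₂
  ... | inj₁ e₁≤e₂ = e₁ , 0<e₁ , λ e≤ → p e≤ , r (≤-trans e≤ e₁≤e₂)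
  ... | inj₂ e₂≤e₁ = e₂ , 0<e₂ , λ e≤ → p (≤-trans e≤ e₂≤e₁) , r e≤

  -- Equality need not be decidable, hence the double negation, which commutes
  -- with the finitely many choices to be made.
  Eventually : ∀ {p} → (Carrier → Set p) → Set _
  Eventually P = ¬ ¬ Near0 P

  -- Brings plain double negations under `Eventually`, so that the lemmas on finite choice apply to
  -- them as well.
  eventually-const : ∀ {p} {A : Set p} → ¬ ¬ A → Eventually (λ _ → A)
  eventually-const ¬¬a k = ¬¬a λ a → k (1# , 0<1 , λ _ → a)

  eventually-map : ∀ {p r} {P : Carrier → Set p} {R : Carrier → Set r} →
                   (∀ {e} → P e → R e) → Eventually P → Eventually R
  eventually-map P⇒R ev k = ev λ (e , 0<e , p) → k (e , 0<e , P⇒R ∘ p)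

  eventually-× : ∀ {p r} {P : Carrier → Set p} {R : Carrier → Set r} →
                 Eventually P → Eventually R → Eventually (λ e → P e × R e)
  eventually-× evP evR k = evP λ p → evR λ r → k (near0-× p r)

  eventually-Fin : ∀ {p n} {P : Fin n → Carrier → Set p} →
                   (∀ i → Eventually (P i)) → Eventually (λ e → ∀ i → P i e)
  eventually-Fin {n = zero}  ev k = k (1# , 0<1 , λ _ ())
  eventually-Fin {n = suc n} ev =
    eventually-map (λ (p , ps) → λ { zero → p ; (suc i) → ps i })
      (eventually-× (ev zero) (eventually-Fin (ev ∘ suc)))

  -- Reduces a bounded quantifier with irrelevant bound to `Fin n`, over which the double negation
  -- can be moved outside.
  eventually-< : ∀ {p n} {P : ∀ j → .(j ℕ.< n) → Carrier → Set p} →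
                 (∀ j (j<n : j ℕ.< n) → Eventually (P j j<n)) →
                 Eventually (λ e → ∀ j .(j<n : j ℕ.< n) → P j j<n e)
  eventually-< {n = n} {P} ev =
    eventually-map spread (eventually-Fin λ i → ev (toℕ i) (Fin.toℕ<n i))
    where
    transport : ∀ {i j e} .{i<n : i ℕ.< n} .{j<n : j ℕ.< n} → i ≡ j → P i i<n e → P j j<n e
    transport ≡.refl p = p
    spread : ∀ {e} → (∀ i → P (toℕ i) (Fin.toℕ<n i) e) → ∀ j .(j<n : j ℕ.< n) → P j j<n e
    spread p j j<n = transport (Fin.toℕ-fromℕ< j<n) (p (Fin.fromℕ< j<n))

  -- Either the inequality between `u` and `v` is tight, or its slack allows each side to move by
  -- `e`.
  Gap : Carrier → Carrier → Carrier → Set (ℓ₁ ⊔ ℓ₂)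
  Gap e u v = u ≈ v ⊎ u + (e + e) ≤ v

  eventually-gap : ∀ {u v} → u ≤ v → Eventually (λ e → Gap e u v)
  eventually-gap {u} {v} u≤v k = ¬¬-excluded-middle no-gap
    where
    no-gap : ¬ Dec (u ≈ v)
    no-gap (yes u≈v) = k (1# , 0<1 , λ _ → inj₁ u≈v)
    no-gap (no  u≉v) = k (w , (*-nonneg (proj₁ 0<½) (x≤y⇒0≤y-x u≤v) , w≉0) , λ {e} e≤w → inj₂ (begin
      u + (e + e)               ≤⟨ +-monoʳ-≤ u (+-mono-≤ e≤w e≤w) ⟩
      u + (w + w)               ≈⟨ +-congˡ (distribʳ (v - u) ½ ½) ⟨
      u + (½ + ½) * (v - u)     ≈⟨ +-congˡ (*-congʳ ½+½≈1) ⟩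
      u + 1# * (v - u)          ≈⟨ +-congˡ (*-identityˡ (v - u)) ⟩
      u + (v - u)               ≈⟨ +-comm u (v - u) ⟩
      v - u + u                 ≈⟨ x-y+y≈x u v ⟩
      v                         ∎))
      where
      -- Half of the difference, so that `w + w` is exactly the available slack.
      w = ½ * (v - u)
      w≉0 : ¬ (0# ≈ w)
      w≉0 0≈w = u≉v (sym (x-y≈0⇒x≈y v u (*-cancelˡ-≈0 (proj₂ 0<½ ∘ sym) (sym 0≈w))))

  -- Tight inequalities survive because equal numbers have equal fractional
  -- parts, the others because fractional parts differ by at most 1.
  perturb-≤ : ∀ {e u v k l} → 0# ≤ e → Gap e u v →
              (A : Floor (k · u)) (A′ : Floor (l · u)) (B : Floor (k · v)) (B′ : Floor (l · v)) →
              u + e * (frac A - frac A′) ≤ v + e * (frac B - frac B′)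
  perturb-≤ {k = k} {l} 0≤e (inj₁ u≈v) A A′ B B′ = ≤-reflexive
    (+-cong u≈v (*-congˡ (+-cong (frac-cong (×-congʳ k u≈v) A B)
                                 (-‿cong (frac-cong (×-congʳ l u≈v) A′ B′)))))
  perturb-≤ {e} {u} {v} 0≤e (inj₂ gap) A A′ B B′ = begin
    u + e * (frac A - frac A′)           ≤⟨ +-monoʳ-≤ u (*-monoˡ-≤ 0≤e a≤1) ⟩
    u + e * 1#                           ≈⟨ +-congˡ (*-identityʳ e) ⟩
    u + e                                ≤⟨ +-cancelʳ-≤ e (begin
      u + e + e                               ≈⟨ +-assoc u e e ⟩
      u + (e + e)                             ≤⟨ gap ⟩
      v                                       ≈⟨ +-identityʳ v ⟨
      v + 0#                                  ≤⟨ +-monoʳ-≤ v (*-nonneg 0≤e 0≤b+1) ⟩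
      v + e * (frac B - frac B′ + 1#)         ≈⟨ solve 3 (λ v e b → v :+ e :* (b :+ con 1) := v :+ e :* b :+ e)
                                                   refl v e (frac B - frac B′) ⟩
      v + e * (frac B - frac B′) + e          ∎) ⟩
    v + e * (frac B - frac B′)           ∎
    where
    a≤1 : frac A - frac A′ ≤ 1#
    a≤1 = +-cancelʳ-≤ (frac A′) (begin
      frac A - frac A′ + frac A′   ≈⟨ x-y+y≈x (frac A′) (frac A) ⟩
      frac A                       ≤⟨ frac≤1 A ⟩
      1#                           ≈⟨ +-identityʳ 1# ⟨
      1# + 0#                      ≤⟨ +-monoʳ-≤ 1# (frac-nonneg A′) ⟩
      1# + frac A′                 ∎)
    0≤b+1 : 0# ≤ frac B - frac B′ + 1#
    0≤b+1 = +-cancelʳ-≤ (frac B′) (begin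
      0# + frac B′                      ≈⟨ +-identityˡ _ ⟩
      frac B′                           ≤⟨ frac≤1 B′ ⟩
      1#                                ≈⟨ +-identityˡ 1# ⟨
      0# + 1#                           ≤⟨ +-monoˡ-≤ 1# (frac-nonneg B) ⟩
      frac B + 1#                       ≈⟨ +-congʳ (x-y+y≈x (frac B′) (frac B)) ⟨
      frac B - frac B′ + frac B′ + 1#   ≈⟨ solve 2 (λ b f → b :+ f :+ con 1 := b :+ con 1 :+ f)
                                             refl (frac B - frac B′) (frac B′) ⟩
      frac B - frac B′ + 1# + frac B′   ∎)

  -- The direction `f - g` has sum zero. Applied row by row, this keeps the weight conditions
  -- intact.
  sum-perturb : ∀ {n} e (x f g : Vector Carrier n) → sum f ≈ sum g →
                sum (λ i → x i + e * (f i - g i)) ≈ sum x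
  sum-perturb e x f g Σf≈Σg = begin-equality
    sum (λ i → x i + e * d i)       ≈⟨ ∑-distrib-+ x (λ i → e * d i) ⟩
    sum x + sum (λ i → e * d i)     ≈⟨ +-congˡ (*-distribˡ-sum e d) ⟨
    sum x + e * sum d               ≈⟨ +-congˡ (*-congˡ Σd≈0) ⟩
    sum x + e * 0#                  ≈⟨ +-congˡ (zeroʳ e) ⟩
    sum x + 0#                      ≈⟨ +-identityʳ _ ⟩
    sum x                           ∎
    where
    d : Vector Carrier _
    d i = f i - g i
    Σd≈0 : sum d ≈ 0#
    Σd≈0 = +-cancelʳ (sum g) _ _ (begin-equality
      sum d + sum g                 ≈⟨ ∑-distrib-+ d g ⟨
      sum (λ i → d i + g i)         ≈⟨ sum-cong-≋ (λ i → x-y+y≈x (g i) (f i)) ⟩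
      sum f                         ≈⟨ Σf≈Σg ⟩
      sum g                         ≈⟨ +-identityˡ _ ⟨
      0# + sum g                    ∎)

  perturb-midpoint : ∀ e x f g →
    x ≈ (1# - ½) * (x + e * (f - g)) + ½ * (x + e * (g - f))
  perturb-midpoint e x f g = sym (begin-equality
    (1# - ½) * (x + e * (f - g)) + ½ * (x + e * (g - f))  ≈⟨ +-congʳ (*-congʳ 1-½≈½) ⟩
    ½ * (x + e * (f - g)) + ½ * (x + e * (g - f))
      -- The two opposite directions enter the solver as independent atoms `d` and `d′`; that they
      -- cancel is used in the next step.
      ≈⟨ solve 5 (λ h x e d d′ → h :* (x :+ e :* d) :+ h :* (x :+ e :* d′)
                               := (h :+ h) :* x :+ h :* e :* (d :+ d′))
           refl ½ x e (f - g) (g - f) ⟩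
    (½ + ½) * x + ½ * e * ((f - g) + (g - f))
      ≈⟨ +-cong (trans (*-congʳ ½+½≈1) (*-identityˡ x))
                (*-congˡ (trans (+-congˡ (sym (-[x-y]≈y-x f g))) (-‿inverseʳ (f - g)))) ⟩
    x + ½ * e * 0#      ≈⟨ +-congˡ (zeroʳ _) ⟩
    x + 0#              ≈⟨ +-identityʳ x ⟩
    x                   ∎)

-- Fractional parts and perturbations of points of a GT-polytope

module GTProperties {c ℓ₁ ℓ₂} (K : OrderedField c ℓ₁ ℓ₂) where
  open OrderedField K hiding (zero)
  open GelfandTsetlin K
  open OrderedFieldProperties K
  open ≤-Reasoning

  fromℤ-bounded : ∀ z → fromℤ z ≤ ℤ.∣ z ∣ · 1#
  fromℤ-bounded (ℤ.+ k)    = ≤-refl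
  fromℤ-bounded ℤ.-[1+ k ] = +-cancelʳ-≤ (suc k · 1#) (begin
    - (suc k · 1#) + suc k · 1#    ≈⟨ -‿inverseˡ _ ⟩
    0#                             ≈⟨ +-identityʳ 0# ⟨
    0# + 0#                        ≤⟨ +-mono-≤ 0≤1+k 0≤1+k ⟩
    suc k · 1# + suc k · 1#        ∎)
    where
    0≤1+k = ×-nonneg (suc k) 0≤1

  fromℤ-nonneg : ∀ z → 0# ≤ fromℤ z → fromℤ z ≈ ℤ.∣ z ∣ · 1#
  fromℤ-nonneg (ℤ.+ k)    0≤z = refl
  fromℤ-nonneg ℤ.-[1+ k ] 0≤z = contradiction (begin
    suc k · 1#                     ≈⟨ +-identityˡ _ ⟨
    0# + suc k · 1#                ≤⟨ +-monoˡ-≤ (suc k · 1#) 0≤z ⟩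
    - (suc k · 1#) + suc k · 1#    ≈⟨ -‿inverseˡ _ ⟩
    0#                             ∎) (1+-positive (×-nonneg k 0≤1))

  module _ {n} {lam mu : Vector ℤ.ℤ n} {x : X n} (x∈GT : GT lam mu x) where
    open GT x∈GT
    open IsGTPattern isGTPattern

    -- Every entry lies below an integer, so integer parts exist even when the
    -- field is not Archimedean.
    entry-bounded : ∀ d j → d ℕ.+ j ≡ n → (j≤n : j ℕ.≤ n) (i : Fin j) →
                    Σ ℕ λ N → x j j≤n i ≤ N · 1#
    entry-bounded zero    j ≡.refl j≤n i = ℤ.∣ lam i ∣ , (begin
      x n j≤n i               ≈⟨ top i ⟩
      fromℤ (lam i)           ≤⟨ fromℤ-bounded (lam i) ⟩
      ℤ.∣ lam i ∣ · 1#        ∎)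
    entry-bounded (suc d) j eq j≤n i = proj₁ next , ≤-trans (upper j j<n i) (proj₂ next)
      where
      j<n : j ℕ.< n
      j<n = ≡.subst (suc j ℕ.≤_) eq (ℕ.s≤s (ℕ.m≤n+m j d))
      next = entry-bounded d (suc j) (≡.trans (ℕ.+-suc d j) eq) j<n (Fin.inject₁ i)

    ¬¬-floor-entry : ∀ k j (j≤n : j ℕ.≤ n) i → ¬ ¬ Floor (k · x j j≤n i)
    ¬¬-floor-entry k j j≤n i with N , x≤N ← entry-bounded (n ℕ.∸ j) j (ℕ.m∸n+n≡m j≤n) j≤n i =
      ¬¬-floor (k ℕ.* N) (×-nonneg k (nonneg j j≤n i)) (begin
        k · x j j≤n i       ≤⟨ ×-monoʳ-≤ k x≤N ⟩
        k · (N · 1#)        ≈⟨ ×-assocˡ 1# k N ⟩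
        (k ℕ.* N) · 1#      ∎)

    -- Re-indexes `weight` from `Fin n` to natural numbers, the form needed for induction on rows.
    row-weight : ∀ j .(j<n : j ℕ.< n) → Σ ℤ.ℤ λ z →
                 sum (x (suc j) j<n) - sum (x j (ℕ.<⇒≤ j<n)) ≈ fromℤ z
    row-weight j j<n = transport (Fin.fromℕ< j<n) (Fin.toℕ-fromℕ< j<n)
      where
      transport : ∀ {j} .{j<n : j ℕ.< n} (k : Fin n) → toℕ k ≡ j → Σ ℤ.ℤ λ z →
                  sum (x (suc j) j<n) - sum (x j (ℕ.<⇒≤ j<n)) ≈ fromℤ z
      transport k ≡.refl = mu k , weight k

    -- Row 0 is empty, and each weight condition adds an integer to the previous row sum.
    row-integral : ∀ j .(j≤n : j ℕ.≤ n) → IsIntegral (sum (x j j≤n))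
    row-integral zero    _   = 0 , 0 , +-identityʳ 0#
    row-integral (suc j) j<n with z , eq ← row-weight j j<n =
      integral-cong (x-y+y≈x _ _)
        (integral-+ (integral-cong (sym eq) (integral-fromℤ z)) (row-integral j (ℕ.<⇒≤ j<n)))

    -- The bound is irrelevant, as in `X n`, so that the fractional parts of `k x` again form an
    -- array.
    record Floors (k : ℕ) : Set (ℓ₁ ⊔ ℓ₂) where
      field at : ∀ j .(j≤n : j ℕ.≤ n) (i : Fin j) → Floor (k · x j j≤n i)

    open Floors public

    fracs : ∀ {k} → Floors k → X n
    fracs f j j≤n i = frac (at f j j≤n i)

    perturb : ∀ {k l} → Carrier → Floors k → Floors l → X n
    perturb e f g j j≤n i = x j j≤n i + e * (fracs f j j≤n i - fracs g j j≤n i)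

    -- A single `e` must suit all the defining inequalities of a GT-pattern simultaneously.
    record Gaps (e : Carrier) : Set (ℓ₁ ⊔ ℓ₂) where
      field
        nonneg-gap : ∀ j .(j≤n : j ℕ.≤ n) (i : Fin j) → Gap e 0# (x j j≤n i)
        upper-gap  : ∀ j .(j<n : j ℕ.< n) (i : Fin j) →
                     Gap e (x j (ℕ.<⇒≤ j<n) i) (x (suc j) j<n (Fin.inject₁ i))
        lower-gap  : ∀ j .(j<n : j ℕ.< n) (i : Fin j) →
                     Gap e (x (suc j) j<n (suc i)) (x j (ℕ.<⇒≤ j<n) i)

    eventually-rows : ∀ {p} {P : ∀ j → .(j ℕ.≤ n) → Fin j → Carrier → Set p} →
                      (∀ j (j≤n : j ℕ.≤ n) i → Eventually (P j j≤n i)) →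
                      Eventually (λ e → ∀ j .(j≤n : j ℕ.≤ n) i → P j j≤n i e)
    eventually-rows {P = P} ev = eventually-map shift
      (eventually-< {n = suc n} {P = λ j j<1+n e → ∀ i → P j (ℕ.s≤s⁻¹ j<1+n) i e}
        λ j j<1+n → eventually-Fin (ev j (ℕ.s≤s⁻¹ j<1+n)))
      where
      shift : ∀ {e} → (∀ j .(j<1+n : j ℕ.< suc n) i → P j (ℕ.s≤s⁻¹ j<1+n) i e) →
              ∀ j .(j≤n : j ℕ.≤ n) i → P j j≤n i e
      shift p j j≤n = p j (ℕ.s≤s j≤n)

    eventually-gaps : Eventually Gaps
    eventually-gaps =
      eventually-map (λ (p , q , r) → record { nonneg-gap = p ; upper-gap = q ; lower-gap = r })
        (eventually-× (eventually-rows λ j j≤n i → eventually-gap (nonneg j j≤n i))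
        (eventually-× (eventually-< λ j j<n → eventually-Fin λ i → eventually-gap (upper j j<n i))
                      (eventually-< λ j j<n → eventually-Fin λ i → eventually-gap (lower j j<n i))))

    -- Only finitely many floors are chosen, one for each multiplier and entry, so the double
    -- negations combine into one. The threshold supplied by `Eventually` is discarded.
    ¬¬-floors : ∀ q → ¬ ¬ (∀ (k : Fin q) → Floors (toℕ k))
    ¬¬-floors q no-floors =
      eventually-Fin (λ k → eventually-rows λ j j≤n i →
        eventually-const (¬¬-floor-entry (toℕ k) j j≤n i))
      λ (_ , _ , fl) → no-floors λ k → record { at = fl ≤-refl k }

    SameRowSums : ∀ {k l} → Floors k → Floors l → Set ℓ₁
    SameRowSums f g = ∀ j (j≤n : j ℕ.≤ n) → sum (fracs f j j≤n) ≈ sum (fracs g j j≤n)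

    top-frac : ∀ {k} (f : Floors k) i → fracs f n ℕ.≤-refl i ≈ 0#
    top-frac {k} f i = frac-integral (at f n ℕ.≤-refl i)
      (integral-× k (integral-cong (sym (top i)) (integral-fromℤ (lam i))))

    -- The inequalities survive by `perturb-≤`, the top row is fixed since its fractional parts
    -- vanish, and equal row sums of `f` and `g` preserve the weights.
    perturb-GT : ∀ {k l e} (f : Floors k) (g : Floors l) → 0# ≤ e → Gaps e →
                 SameRowSums f g → GT lam mu (perturb e f g)
    perturb-GT {k} {l} {e} f g 0≤e gaps same = record
      { isGTPattern = record
        -- The constant 0 is treated like an entry: the fractional parts of its multiples vanish, so
        -- its perturbation is 0 and `perturb-≤` applies.
        { nonneg = λ j j≤n i → begin
            0#                       ≈⟨ +-identityˡ 0# ⟨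
            0# + 0#                  ≈⟨ +-congˡ (zeroʳ e) ⟨
            0# + e * 0#              ≈⟨ +-congˡ (*-congˡ (-‿inverseʳ (frac (floor-0 k)))) ⟨
            0# + e * (frac (floor-0 k) - frac (floor-0 k))
              ≈⟨ +-congˡ (*-congˡ (+-congˡ (-‿cong (trans (frac-0 k) (sym (frac-0 l)))))) ⟩
            0# + e * (frac (floor-0 k) - frac (floor-0 l))
              ≤⟨ perturb-≤ {k = k} {l} 0≤e (nonneg-gap j j≤n i)
                   (floor-0 k) (floor-0 l) (at f j j≤n i) (at g j j≤n i) ⟩
            perturb e f g j j≤n i    ∎
        ; upper = λ j j<n i → perturb-≤ {k = k} {l} 0≤e (upper-gap j j<n i)
            (at f j (ℕ.<⇒≤ j<n) i) (at g j (ℕ.<⇒≤ j<n) i)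
            (at f (suc j) j<n (Fin.inject₁ i)) (at g (suc j) j<n (Fin.inject₁ i))
        ; lower = λ j j<n i → perturb-≤ {k = k} {l} 0≤e (lower-gap j j<n i)
            (at f (suc j) j<n (suc i)) (at g (suc j) j<n (suc i))
            (at f j (ℕ.<⇒≤ j<n) i) (at g j (ℕ.<⇒≤ j<n) i)
        }
      ; top = λ i → begin-equality
          perturb e f g n ℕ.≤-refl i     ≈⟨ +-congˡ (*-congˡ (+-cong (top-frac f i) (-‿cong (top-frac g i)))) ⟩
          x n ℕ.≤-refl i + e * (0# - 0#) ≈⟨ +-congˡ (*-congˡ (-‿inverseʳ 0#)) ⟩
          x n ℕ.≤-refl i + e * 0#        ≈⟨ +-congˡ (zeroʳ e) ⟩
          x n ℕ.≤-refl i + 0#            ≈⟨ +-identityʳ _ ⟩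
          x n ℕ.≤-refl i                 ≈⟨ top i ⟩
          fromℤ (lam i)                  ∎
      ; weight = λ k → trans (+-cong (sum-row (suc (toℕ k)) (Fin.toℕ<n k))
                                     (-‿cong (sum-row (toℕ k) (ℕ.<⇒≤ (Fin.toℕ<n k)))))
                             (weight k)
      }
      where
      open Gaps gaps
      floor-0 : ∀ k → Floor (k · 0#)
      floor-0 k = record
        { floor   = 0
        ; floor-≤ = ×-nonneg k ≤-refl
        ; floor-< = begin-strict
            k · 0#   ≈⟨ ×-zeroʳ k ⟩
            0#       <⟨ 0<1 ⟩
            1#       ≈⟨ +-identityʳ 1# ⟨
            1 · 1#   ∎
        }
      frac-0 : ∀ k → frac (floor-0 k) ≈ 0#
      frac-0 k = frac-integral (floor-0 k) (integral-× k (0 , 0 , +-identityʳ 0#))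
      sum-row : ∀ j (j≤n : j ℕ.≤ n) → sum (perturb e f g j j≤n) ≈ sum (x j j≤n)
      sum-row j j≤n = sum-perturb e (x j j≤n) (fracs f j j≤n) (fracs g j j≤n) (same j j≤n)

  -- Swapping `f` and `g` reverses the direction, so `x` is the midpoint of two points of the
  -- polytope. Extremality makes `e * d` vanish, and `e` is nonzero.
  vertex-fracs : ∀ {n} {lam mu : Vector ℤ.ℤ n} {x : X n} (v : IsVertex (GT lam mu) x) →
                 let x∈GT = IsVertex.member v in
                 ∀ {k l e} (f : Floors x∈GT k) (g : Floors x∈GT l) → 0# < e → Gaps x∈GT e →
                 SameRowSums x∈GT f g → fracs x∈GT f ≋ fracs x∈GT g
  vertex-fracs {x = x} v {e = e} f g 0<e gaps same j j≤n i =
    x-y≈0⇒x≈y _ _ (*-cancelˡ-≈0 (proj₂ 0<e ∘ sym) (+-cancelʳ (x j j≤n i) _ _ (begin-equality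
      e * d + x j j≤n i   ≈⟨ +-comm _ _ ⟩
      x j j≤n i + e * d   ≈⟨ proj₁ (extreme (perturb member e f g) (perturb member e g f) ½
                               (perturb-GT member f g (proj₁ 0<e) gaps same)
                               (perturb-GT member g f (proj₁ 0<e) gaps (λ j j≤n → sym (same j j≤n)))
                               0<½ ½<1
                               (λ j j≤n i → perturb-midpoint e (x j j≤n i) _ _)) j j≤n i ⟩
      x j j≤n i           ≈⟨ +-identityˡ _ ⟨
      0# + x j j≤n i      ∎)))
    where
    open IsVertex v
    d = fracs member f j j≤n i - fracs member g j j≤n i

  -- Denominators and integral multiples

  denominator-∣ : ∀ {q a} → IsDenominatorOf q a → 0# ≤ a → ∀ l → IsIntegral (l · a) → q ∣ l
  denominator-∣ {q} {a} den 0≤a l int-la with t , la≈t ← integral-nonneg int-la (×-nonneg l 0≤a) =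
    -- Writing `l · a` as the natural number `t` gives `p * l` = `t * q`; since `p` and `q` are
    -- coprime, `q` divides `l`.
    coprime-divisor (Coprimality.sym reduced) (divides t (×1-injective (begin-equality
      (p ℕ.* l) · 1#    ≡⟨ ≡.cong (_· 1#) (ℕ.*-comm p l) ⟩
      (l ℕ.* p) · 1#    ≈⟨ ×-assocˡ 1# l p ⟨
      l · (p · 1#)      ≈⟨ ×-congʳ l qa≈p ⟨
      l · (q · a)       ≈⟨ ×-assocˡ a l q ⟩
      (l ℕ.* q) · a     ≡⟨ ≡.cong (_· a) (ℕ.*-comm l q) ⟩
      (q ℕ.* l) · a     ≈⟨ ×-assocˡ a q l ⟨
      q · (l · a)       ≈⟨ ×-congʳ q la≈t ⟩
      q · (t · 1#)      ≈⟨ ×-assocˡ 1# q t ⟩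
      (q ℕ.* t) · 1#    ≡⟨ ≡.cong (_· 1#) (ℕ.*-comm q t) ⟩
      (t ℕ.* q) · 1#    ∎)))
    where
    open IsDenominatorOf den
    p = ℤ.∣ numerator ∣
    qa≈p : q · a ≈ p · 1#
    qa≈p = trans fraction (fromℤ-nonneg numerator (begin
      0#              ≤⟨ ×-nonneg q 0≤a ⟩
      q · a           ≈⟨ fraction ⟩
      fromℤ numerator ∎))

  -- With equal fractional parts, the two multiples of `a` differ by the difference of their floors.
  -- The larger multiplier is written `l + k` to avoid subtraction.
  frac≈⇒integral : ∀ {a} k l (A : Floor (k · a)) (B : Floor ((l ℕ.+ k) · a)) →
                   frac A ≈ frac B → IsIntegral (l · a)
  frac≈⇒integral {a} k l A B fracA≈fracB = floor B , floor A , +-cancelʳ (frac A) _ _ (begin-equality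
    l · a + floor A · 1# + frac A     ≈⟨ +-assoc _ _ _ ⟩
    l · a + (floor A · 1# + frac A)   ≈⟨ +-congˡ (trans (+-comm _ _) (frac+floor A)) ⟩
    l · a + k · a                     ≈⟨ ×-homo-+ a l k ⟨
    (l ℕ.+ k) · a                     ≈⟨ frac+floor B ⟨
    frac B + floor B · 1#             ≈⟨ +-congʳ fracA≈fracB ⟨
    frac A + floor B · 1#             ≈⟨ +-comm _ _ ⟩
    floor B · 1# + frac A             ∎)

  -- Coding row sums and the pigeonhole argument

  module _ {m : ℕ} {lam mu : Vector ℤ.ℤ (suc m)} {x : X (suc m)} (x∈GT : GT lam mu x) where

    -- Only rows 1 to `m` are recorded: row 0 is empty, and the fractional parts in the top row
    -- `suc m` vanish. Row `suc j` has `suc j` possible sums, hence `m !` codes.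
    Residues : ∀ {k} → Floors x∈GT k → Set ℓ₁
    Residues f = ∀ j .(j<m : j ℕ.< m) →
      Σ (Fin (suc j)) λ s → sum (fracs x∈GT f (suc j) (ℕ.m≤n⇒m≤1+n j<m)) ≈ toℕ s · 1#

    residues : ∀ {k} (f : Floors x∈GT k) → Residues f
    residues {k} f j j<m = sum-frac-residue k (x (suc j) (ℕ.m≤n⇒m≤1+n j<m))
      (at f (suc j) (ℕ.m≤n⇒m≤1+n j<m))
      (row-integral x∈GT (suc j) (ℕ.m≤n⇒m≤1+n j<m))

    code : ∀ {k} (f : Floors x∈GT k) → Residues f → Fin (m !)
    code f r = mixedRadix m λ j j<m → proj₁ (r j j<m)

    code≡⇒sameRowSums : ∀ {k l} (f : Floors x∈GT k) (g : Floors x∈GT l)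
                        (r : Residues f) (s : Residues g) → code f r ≡ code g s → SameRowSums x∈GT f g
    code≡⇒sameRowSums f g r s eq zero    _   = refl
    code≡⇒sameRowSums f g r s eq (suc j) j<n with ℕ.m<1+n⇒m<n∨m≡n j<n
    ... | inj₁ j<m = trans (proj₂ (r j j<m)) (trans
      (reflexive (≡.cong (λ s → toℕ s · 1#) (mixedRadix-injective m _ _ eq j j<m)))
      (sym (proj₂ (s j j<m))))
    -- The top row has no digit in the code; both of its sums vanish entry by entry.
    ... | inj₂ ≡.refl = sum-cong-≋ λ i →
      trans (top-frac x∈GT f i) (sym (top-frac x∈GT g i))

  vertex-denominator-∣ : ∀ {n q} {lam mu : Vector ℤ.ℤ n} {x : X n} (v : IsVertex (GT lam mu) x) →
    let x∈GT = IsVertex.member v in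
    ∀ {k l e} (f : Floors x∈GT k) (g : Floors x∈GT (l ℕ.+ k)) → 0# < e → Gaps x∈GT e →
    SameRowSums x∈GT f g → ∀ j (j≤n : j ℕ.≤ n) i → IsDenominatorOf q (x j j≤n i) → q ∣ l
  vertex-denominator-∣ v {k} {l} f g 0<e gaps same j j≤n i den =
    denominator-∣ den (IsGTPattern.nonneg (GT.isGTPattern (IsVertex.member v)) j j≤n i) l
      (frac≈⇒integral k l (at f j j≤n i) (at g j j≤n i) (vertex-fracs v f g 0<e gaps same j j≤n i))

  denominator-≤-! : ∀ m q → AppearsAsDenominator (suc m) q → q ℕ.≤ m !
  -- Refuting `m ! < q` makes the goal a contradiction, so the floors and the parameter `e`, known
  -- only up to double negation, can be extracted.
  denominator-≤-! m q (lam , mu , x , v , j , j≤n , i , den) = ℕ.≮⇒≥ λ m!<q →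
    ¬¬-floors member q λ fl → eventually-gaps member λ (e , 0<e , gaps) →
    collision m!<q fl (λ k → residues member (fl k)) 0<e (gaps ≤-refl)
    where
    open IsVertex v
    collision : m ! ℕ.< q → (fl : ∀ (k : Fin q) → Floors member (toℕ k)) →
                (∀ k → Residues member (fl k)) → ∀ {e} → 0# < e → ¬ Gaps member e
    collision m!<q fl res 0<e gaps
      with k , l , k<l , eq ← Fin.pigeonhole m!<q (λ k → code member (fl k) (res k)) =
      -- The two colliding multipliers are distinct and below `q`, so their difference `d` is
      -- positive and less than `q`, yet `q` would divide it.
      ℕ.<⇒≱ d<q (∣⇒≤ {{ℕ.>-nonZero (ℕ.m<n⇒0<n∸m k<l)}}
        (divides-difference (≡.sym (ℕ.m∸n+n≡m (ℕ.<⇒≤ k<l))) (fl l)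
          (code≡⇒sameRowSums member (fl k) (fl l) (res k) (res l) eq)))
      where
      d = toℕ l ℕ.∸ toℕ k
      d<q : d ℕ.< q
      d<q = ℕ.≤-<-trans (ℕ.m∸n≤m (toℕ l) (toℕ k)) (Fin.toℕ<n l)
      -- The larger multiplier is generalised to a variable so that matching on the equation turns
      -- `Floors member l` into floors for `d + toℕ k`.
      divides-difference : ∀ {l d} → l ≡ d ℕ.+ toℕ k → (g : Floors member l) →
                           SameRowSums member (fl k) g → q ∣ d
      divides-difference ≡.refl g same = vertex-denominator-∣ v (fl k) g 0<e gaps same j j≤n i den

-- Comparing the factorial with the claimed power

open import Data.Nat using (_+_; _∸_; _^_; _≤_; _<_)
open import Data.Nat.Combinatorics using (_C_; nC1≡n; nCk+nC[k+1]≡[n+1]C[k+1])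
open import Relation.Binary.PropositionalEquality using (_≢_)

!≤^ : ∀ m → m ! ≤ m ^ m
!≤^ zero    = ℕ.≤-refl
!≤^ (suc m) = ℕ.*-monoʳ-≤ (suc m) (ℕ.≤-trans (!≤^ m) (ℕ.^-monoˡ-≤ m (ℕ.n≤1+n m)))

-- One factor equals the base; the others are bounded by powers of `1 + m`, strictly below the base.
!<^ : ∀ m → (2 + m) ! < (2 + m) ^ (2 + m)
!<^ m = ℕ.*-monoʳ-< (2 + m) (ℕ.≤-<-trans (!≤^ (1 + m)) (ℕ.^-monoˡ-< (1 + m) (ℕ.n<1+n (1 + m))))

1+nC2 : ∀ n → (1 + n) C 2 ≡ n + n C 2
1+nC2 n = ≡.trans (≡.sym (nCk+nC[k+1]≡[n+1]C[k+1] n 1)) (≡.cong (_+ n C 2) (nC1≡n n))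

-- For n = `3 + m`, Pascal's rule reduces the exponent to C(n, 2) - 1 = (n - 1) + C(n - 1, 2) - 1,
-- and C(n - 1, 2) is at least 1.
exponent-≥ : ∀ m → 2 + m ≤ ((3 + m + 1) C 2) ∸ (3 + m) ∸ 1
exponent-≥ m = begin
  2 + m                                  ≡⟨ ℕ.+-comm 1 (1 + m) ⟩
  1 + m + 1                              ≤⟨ ℕ.+-monoʳ-≤ (1 + m) (ℕ.s≤s ℕ.z≤n) ⟩
  1 + m + (1 + m + (1 + m) C 2)          ≡⟨ ≡.cong (λ k → 1 + m + k) (1+nC2 (1 + m)) ⟨
  2 + m + (2 + m) C 2 ∸ 1                ≡⟨ ≡.cong (_∸ 1) (1+nC2 (2 + m)) ⟨
  (3 + m) C 2 ∸ 1                        ≡⟨ ≡.cong (_∸ 1) (ℕ.m+n∸m≡n (3 + m) ((3 + m) C 2)) ⟨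
  3 + m + (3 + m) C 2 ∸ (3 + m) ∸ 1      ≡⟨ ≡.cong (λ k → k ∸ (3 + m) ∸ 1) (1+nC2 (3 + m)) ⟨
  ((4 + m) C 2) ∸ (3 + m) ∸ 1            ≡⟨ ≡.cong (λ k → (k C 2) ∸ (3 + m) ∸ 1) (ℕ.+-comm 1 (3 + m)) ⟩
  ((3 + m + 1) C 2) ∸ (3 + m) ∸ 1        ∎
  where open ℕ.≤-Reasoning

denominator-≤1⇒≡1 : ∀ {c ℓ₁ ℓ₂} (K : OrderedField c ℓ₁ ℓ₂) n q →
                    GelfandTsetlin.AppearsAsDenominator K n q → q ≤ 1 → q ≡ 1
denominator-≤1⇒≡1 K n q (_ , _ , _ , _ , _ , _ , _ , den) q≤1 =
  ℕ.≤-antisym q≤1 (ℕ.>-nonZero⁻¹ q {{GelfandTsetlin.IsDenominatorOf.positive den}})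

proposition2p5 : ∀ {c ℓ₁ ℓ₂} (K : OrderedField c ℓ₁ ℓ₂) (n q : ℕ) →
    GelfandTsetlin.AppearsAsDenominator K n q →
    (n ≤ 2 → q ≢ 1) →
    q < (n ∸ 1) ^ (((n + 1) C 2) ∸ n ∸ 1)
proposition2p5 K 0 q (_ , _ , _ , _ , _ , ℕ.z≤n , () , _) q≢1
-- For n = 1 and n = 2 the factorial bound is 1, which forces `q` to be 1. The claimed power is also
-- 1 there, so this value has to be excluded by hypothesis.
proposition2p5 K 1 q app q≢1 =
  contradiction (denominator-≤1⇒≡1 K 1 q app (GTProperties.denominator-≤-! K 0 q app))
    (q≢1 (ℕ.s≤s ℕ.z≤n))
proposition2p5 K 2 q app q≢1 =
  contradiction (denominator-≤1⇒≡1 K 2 q app (GTProperties.denominator-≤-! K 1 q app))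
    (q≢1 ℕ.≤-refl)
proposition2p5 K (suc (suc (suc m))) q app q≢1 = begin-strict
  q                                                  ≤⟨ GTProperties.denominator-≤-! K (2 + m) q app ⟩
  (2 + m) !                                          <⟨ !<^ m ⟩
  (2 + m) ^ (2 + m)                                  ≤⟨ ℕ.^-monoʳ-≤ (2 + m) (exponent-≥ m) ⟩
  (2 + m) ^ (((3 + m + 1) C 2) ∸ (3 + m) ∸ 1)        ∎
  where open ℕ.≤-Reasoning
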